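{- Let $p>5$ be a prime. Then $$\sum_{k=0}^{p-1}2^k\binom{3k}{k}\equiv\frac{6(-1)^{(p-1)/2}-1}{5}\pmod p$$ and $$\sum_{k=0}^{p-1}2^k\binom{3k+1}{k}\equiv\frac{4(-1)^{(p-1)/2}+1}{5}\pmod p.$$
   Context: Congruences modulo $p$ between rational numbers whose denominators are prime to $p$ are understood in the ring of rationals with denominator prime to $p$ (i.e. $a\equiv b \pmod p$ means that $a-b$ is $p$ times such a rational). -}

module Defs where

open import Data.Integer.Base using (+_)
open import Data.Nat.Base using (ℕ)
open import Data.Nat.Coprimality using (Coprime)
open import Data.Product.Base using (_×_; ∃-syntax)
open import Data.Rational.Base using (ℚ; ↧ₙ_; _/_; _-_; _*_)
open import Relation.Binary.PropositionalEquality.Core using (_≡_)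

-- The rationals with denominator prime to p. Elements of ℚ are in lowest
-- terms, so ↧ₙ is the reduced denominator.
_-Integral : ℕ → ℚ → Set
(p -Integral) a = Coprime (↧ₙ a) p

infix 4 _≡_[mod_]

-- Congruence modulo p in the ring of p-integral rationals: a and b both lie
-- in that ring, and a - b lies in the ideal generated by p.
_≡_[mod_] : ℚ → ℚ → ℕ → Set
a ≡ b [mod p ] =
  (p -Integral) a × (p -Integral) b ×
  ∃[ r ] ((p -Integral) r × a - b ≡ (+ p / 1) * r)

{-# OPTIONS --safe #-}
-- The number 2^k C(3k+j, k) is the coefficient of v^k in (1 + 2v)^(3k+j). Suppose
-- ((1 + 2v)³ − v) r = 5 (1 + 2v)^j as power series in v. Multiplying by (1 + 2v)^(3k) and
-- comparing coefficients of v^k gives 5 · 2^k C(3k+j, k) as a difference of consecutive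
-- terms, so five times the sum is the coefficient of v^(p-1) in (1 + 2v)^(3p) r. Modulo p
-- that is the coefficient of v^(p-1) in r itself, since (1 + 2v)^p ≡ 1 + (2v)^p. As
-- (1 + 2v)³ − v = (1 + v)(1 + 4v + 8v²), partial fractions write r in terms of (-1)^n and
-- the powers of the Gaussian integer 2i(1 + i) = −2 + 2i, whose (p-1)-st power is found by
-- Frobenius once more.
module Submission where

open import Defs
open import Data.Nat using (ℕ; _+_; _*_; _∸_; _^_; _/_; _<_)
open import Data.Nat.Combinatorics using (_C_)
open import Data.Nat.ListAction using (sum)
open import Data.Nat.Primality using (Prime)
open import Data.Integer as ℤ using (+_; -1ℤ)
open import Data.Rational as ℚ using (ℚ)
open import Data.List using (map; upTo)
open import Data.Product using (_×_)

open import Data.Integer using (ℤ; 0ℤ; 1ℤ)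
open import Data.Integer.Divisibility.Signed
  using (_∣_; divides; ∣m∣n⇒∣m+n; ∣m⇒∣m*n; ∣n⇒∣m*n; ∣⇒∣ᵤ; ∣ᵤ⇒∣)
open import Data.Integer.GCD using (gcd)
import Data.Integer.Properties as ℤ
open import Data.Integer.Tactic.RingSolver using (solve-∀)
open import Data.List using ([]; _∷_; _++_)
open import Data.List.Properties using (upTo-∷ʳ; map-++)
open import Data.Nat using (zero; suc; z<s; s<s)
import Data.Nat as ℕ using (NonZero; _%_)
open import Data.Nat.Combinatorics using (nCn≡1; nC1≡n; k>n⇒nCk≡0; nCk+nC[k+1]≡[n+1]C[k+1])
open import Data.Nat.Coprimality as Coprimality using (Coprime; prime⇒coprime; coprime-divisor)
import Data.Nat.Divisibility as ℕ
import Data.Nat.DivMod as ℕ using (m%n<n; m≡m%n+[m/n]*n; m*n/n≡m)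
open import Data.Nat.ListAction.Properties using (sum-++)
open import Data.Nat.Primality using (euclidsLemma; prime⇒irreducible)
import Data.Nat.Properties as ℕ
open import Data.Nat.Tactic.RingSolver using () renaming (solve-∀ to solve-∀ℕ)
open import Data.Product using (_,_; ∃-syntax)
open import Data.Rational using (toℚᵘ; ↧_; ↧ₙ_)
import Data.Rational.Properties as ℚ
open import Data.Rational.Unnormalised as ℚᵘ using (mkℚᵘ; *≡*)
import Data.Rational.Unnormalised.Properties as ℚᵘ
open import Data.Sum using (inj₁; inj₂)
open import Relation.Binary.PropositionalEquality
open import Relation.Nullary using (contradiction)

-- Binomial coefficients divisible by a prime.

[k+1]*[n+1]C[k+1]≡[n+1]*nCk : ∀ n k → suc k * (suc n C suc k) ≡ suc n * (n C k)
[k+1]*[n+1]C[k+1]≡[n+1]*nCk zero zero = refl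
[k+1]*[n+1]C[k+1]≡[n+1]*nCk zero (suc k) = begin
  suc (suc k) * (1 C suc (suc k)) ≡⟨ cong (suc (suc k) *_) (k>n⇒nCk≡0 {1} {suc (suc k)} (s<s z<s)) ⟩
  suc (suc k) * 0                 ≡⟨ ℕ.*-zeroʳ (suc (suc k)) ⟩
  0                               ≡⟨ cong (1 *_) (k>n⇒nCk≡0 {0} {suc k} z<s) ⟨
  1 * (0 C suc k)                 ∎
  where open ≡-Reasoning
[k+1]*[n+1]C[k+1]≡[n+1]*nCk (suc n) zero = begin
  1 * (suc (suc n) C 1)           ≡⟨ ℕ.*-identityˡ _ ⟩
  suc (suc n) C 1                 ≡⟨ nC1≡n (suc (suc n)) ⟩
  suc (suc n)                     ≡⟨ ℕ.*-identityʳ _ ⟨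
  suc (suc n) * 1                 ∎
  where open ≡-Reasoning
[k+1]*[n+1]C[k+1]≡[n+1]*nCk (suc n) (suc k) = begin
  suc (suc k) * (suc (suc n) C suc (suc k))
    ≡⟨ cong (suc (suc k) *_) (nCk+nC[k+1]≡[n+1]C[k+1] (suc n) (suc k)) ⟨
  suc (suc k) * (x + y)
    ≡⟨ distrib k x y ⟩
  suc k * x + suc (suc k) * y + x
    ≡⟨ cong (_+ x) (cong₂ _+_ ([k+1]*[n+1]C[k+1]≡[n+1]*nCk n k) ([k+1]*[n+1]C[k+1]≡[n+1]*nCk n (suc k))) ⟩
  suc n * (n C k) + suc n * (n C suc k) + x
    ≡⟨ cong (_+ x) (ℕ.*-distribˡ-+ (suc n) (n C k) (n C suc k)) ⟨
  suc n * (n C k + n C suc k) + x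
    ≡⟨ cong (λ z → suc n * z + x) (nCk+nC[k+1]≡[n+1]C[k+1] n k) ⟩
  suc n * x + x
    ≡⟨ ℕ.+-comm (suc n * x) x ⟩
  suc (suc n) * x ∎
  where
  open ≡-Reasoning
  x = suc n C suc k
  y = suc n C suc (suc k)
  distrib : ∀ k x y → suc (suc k) * (x + y) ≡ suc k * x + suc (suc k) * y + x
  distrib = solve-∀ℕ

-- The absorption identity makes p divide (k+1) C(p, k+1), and p cannot divide the smaller number
-- k+1.
prime∣pCk : ∀ {p k} → Prime p → suc k < p → p ℕ.∣ (p C suc k)
prime∣pCk {suc q} {k} pp k<p
  with euclidsLemma (suc k) (suc q C suc k) pp
         (ℕ.divides (q C k) (trans ([k+1]*[n+1]C[k+1]≡[n+1]*nCk q k) (ℕ.*-comm (suc q) (q C k))))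
... | inj₁ p∣k = contradiction (ℕ.∣⇒≤ p∣k) (ℕ.<⇒≱ k<p)
... | inj₂ p∣C = p∣C

-- Finite sums and the expansion of (1 + E)^m.

Σ< : ℕ → (ℕ → ℤ) → ℤ
Σ< zero    g = 0ℤ
Σ< (suc n) g = g 0 ℤ.+ Σ< n (λ i → g (suc i))

Σ<-cong : ∀ n {g h : ℕ → ℤ} → (∀ i → g i ≡ h i) → Σ< n g ≡ Σ< n h
Σ<-cong zero    eq = refl
Σ<-cong (suc n) eq = cong₂ ℤ._+_ (eq 0) (Σ<-cong n (λ i → eq (suc i)))

Σ<-+ : ∀ n (g h : ℕ → ℤ) → Σ< n g ℤ.+ Σ< n h ≡ Σ< n (λ i → g i ℤ.+ h i)
Σ<-+ zero    g h = refl
Σ<-+ (suc n) g h = trans (interchange (g 0) (h 0) _ _) (cong (ℤ._+_ (g 0 ℤ.+ h 0)) (Σ<-+ n _ _))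
  where
  interchange : ∀ a b c d → (a ℤ.+ c) ℤ.+ (b ℤ.+ d) ≡ (a ℤ.+ b) ℤ.+ (c ℤ.+ d)
  interchange = solve-∀

Σ<-last : ∀ n (g : ℕ → ℤ) → Σ< (suc n) g ≡ Σ< n g ℤ.+ g n
Σ<-last zero    g = ℤ.+-comm (g 0) 0ℤ
Σ<-last (suc n) g = trans (cong (ℤ._+_ (g 0)) (Σ<-last n _)) (sym (ℤ.+-assoc (g 0) _ _))

Σ<-∣ : ∀ {d} n (g : ℕ → ℤ) → (∀ i → i < n → d ∣ g i) → d ∣ Σ< n g
Σ<-∣ zero    g d∣g = divides 0ℤ refl
Σ<-∣ (suc n) g d∣g = ∣m∣n⇒∣m+n (d∣g 0 z<s) (Σ<-∣ n _ (λ i i<n → d∣g (suc i) (s<s i<n)))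

-- ((1 + E)^m f) n, where E is the forward shift.
binomial : (ℕ → ℤ) → ℕ → ℕ → ℤ
binomial f zero    n = f n
binomial f (suc m) n = binomial f m n ℤ.+ binomial f m (suc n)

binomial-Σ : ∀ f m n → binomial f m n ≡ Σ< (suc m) (λ i → + (m C i) ℤ.* f (i + n))
binomial-Σ f zero    n = sym (trans (ℤ.+-identityʳ _) (ℤ.*-identityˡ (f n)))
binomial-Σ f (suc m) n = begin
  binomial f m n ℤ.+ binomial f m (suc n)
    ≡⟨ cong₂ ℤ._+_ (binomial-Σ f m n) (binomial-Σ f m (suc n)) ⟩
  Σ< (suc m) (term m) ℤ.+ Σ< (suc m) (λ i → + (m C i) ℤ.* f (i + suc n))
    ≡⟨ cong₂ ℤ._+_ (sym pad) (Σ<-cong (suc m) (λ i → cong (λ j → + (m C i) ℤ.* f j) (ℕ.+-suc i n))) ⟩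
  Σ< (suc (suc m)) (term m) ℤ.+ Σ< (suc m) shifted
    ≡⟨ regroup (term m 0) _ (Σ< (suc m) shifted) ⟩
  term m 0 ℤ.+ (Σ< (suc m) shifted ℤ.+ Σ< (suc m) (λ i → term m (suc i)))
    ≡⟨ cong (ℤ._+_ (term m 0))
         (trans (Σ<-+ (suc m) shifted (λ i → term m (suc i))) (Σ<-cong (suc m) pascal)) ⟩
  Σ< (suc (suc m)) (term (suc m)) ∎
  where
  open ≡-Reasoning
  term : ℕ → ℕ → ℤ
  term m i = + (m C i) ℤ.* f (i + n)
  shifted : ℕ → ℤ
  shifted i = + (m C i) ℤ.* f (suc i + n)
  -- The extra term has coefficient C(m, m+1) = 0; once the term at 0 is split off, both sums have
  -- the same range.
  pad : Σ< (suc (suc m)) (term m) ≡ Σ< (suc m) (term m)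
  pad = trans (Σ<-last (suc m) (term m))
       (trans (cong (λ c → Σ< (suc m) (term m) ℤ.+ + c ℤ.* f (suc m + n)) (k>n⇒nCk≡0 (ℕ.n<1+n m)))
              (ℤ.+-identityʳ _))
  regroup : ∀ a b c → (a ℤ.+ b) ℤ.+ c ≡ a ℤ.+ (c ℤ.+ b)
  regroup = solve-∀
  pascal : ∀ i → + (m C i) ℤ.* f (suc i + n) ℤ.+ term m (suc i) ≡ term (suc m) (suc i)
  pascal i = trans (sym (ℤ.*-distribʳ-+ (f (suc i + n)) (+ (m C i)) (+ (m C suc i))))
                   (cong (λ c → + c ℤ.* f (suc i + n)) (nCk+nC[k+1]≡[n+1]C[k+1] m i))

-- Integer congruences and Frobenius.

infix 4 _≡_⟨mod_⟩
_≡_⟨mod_⟩ : ℤ → ℤ → ℕ → Set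
a ≡ b ⟨mod p ⟩ = + p ∣ a ℤ.- b

mod-trans : ∀ {p a b c} → a ≡ b ⟨mod p ⟩ → b ≡ c ⟨mod p ⟩ → a ≡ c ⟨mod p ⟩
mod-trans {p} {a} {b} {c} x y = subst (+ p ∣_) (eq a b c) (∣m∣n⇒∣m+n x y)
  where
  eq : ∀ a b c → (a ℤ.- b) ℤ.+ (b ℤ.- c) ≡ a ℤ.- c
  eq = solve-∀

mod-- : ∀ {p a b c d} → a ≡ b ⟨mod p ⟩ → c ≡ d ⟨mod p ⟩ → a ℤ.- c ≡ b ℤ.- d ⟨mod p ⟩
mod-- {p} {a} {b} {c} {d} x y = subst (+ p ∣_) (eq a b c d) (∣m∣n⇒∣m+n x (∣n⇒∣m*n -1ℤ y))
  where
  eq : ∀ a b c d → (a ℤ.- b) ℤ.+ -1ℤ ℤ.* (c ℤ.- d) ≡ (a ℤ.- c) ℤ.- (b ℤ.- d)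
  eq = solve-∀

mod-* : ∀ {p a b c d} → a ≡ b ⟨mod p ⟩ → c ≡ d ⟨mod p ⟩ → a ℤ.* c ≡ b ℤ.* d ⟨mod p ⟩
mod-* {p} {a} {b} {c} {d} x y =
  subst (+ p ∣_) (eq a b c d) (∣m∣n⇒∣m+n (∣m⇒∣m*n c x) (∣n⇒∣m*n b y))
  where
  eq : ∀ a b c d → (a ℤ.- b) ℤ.* c ℤ.+ b ℤ.* (c ℤ.- d) ≡ a ℤ.* c ℤ.- b ℤ.* d
  eq = solve-∀

-- (1 + E)^p ≡ 1 + E^p, as the inner coefficients vanish modulo p. Since `f` is arbitrary, this
-- serves for (1 + 2v)^p, for 2^p and for (1 + i)^p alike.
frobenius : ∀ {p} → Prime p → ∀ f n → binomial f p n ≡ f n ℤ.+ f (p + n) ⟨mod p ⟩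
frobenius {suc q} pp f n = subst (+ suc q ∣_) (sym split) (Σ<-∣ q middle p∣middle)
  where
  middle : ℕ → ℤ
  middle i = + (suc q C suc i) ℤ.* f (suc i + n)
  p∣middle : ∀ i → i < q → + suc q ∣ middle i
  p∣middle i i<q = ∣m⇒∣m*n {m = + (suc q C suc i)} (f (suc i + n)) (∣ᵤ⇒∣ (prime∣pCk pp (s<s i<q)))
  cancel : ∀ a b c → (1ℤ ℤ.* a ℤ.+ (b ℤ.+ 1ℤ ℤ.* c)) ℤ.- (a ℤ.+ c) ≡ b
  cancel = solve-∀
  split : binomial f (suc q) n ℤ.- (f n ℤ.+ f (suc q + n)) ≡ Σ< q middle
  split = trans (cong (ℤ._- (f n ℤ.+ f (suc q + n)))
                  (trans (binomial-Σ f (suc q) n)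
                    (cong (ℤ._+_ (1ℤ ℤ.* f n))
                      (trans (Σ<-last q middle)
                        (cong (λ c → Σ< q middle ℤ.+ + c ℤ.* f (suc q + n)) (nCn≡1 (suc q)))))))
                (cancel (f n) (Σ< q middle) (f (suc q + n)))

-- Power series and multiplication by powers of 1 + 2v.

-- A sequence f stands for the power series Σ f n vⁿ; V and W multiply by v and 1 + 2v.
V : (ℕ → ℤ) → ℕ → ℤ
V f zero    = 0ℤ
V f (suc n) = f n

2V^ : ℕ → (ℕ → ℤ) → ℕ → ℤ
2V^ zero    f n = f n
2V^ (suc i) f n = + 2 ℤ.* V (2V^ i f) n

W : (ℕ → ℤ) → ℕ → ℤ
W f n = f n ℤ.+ + 2 ℤ.* V f n

W^ : ℕ → (ℕ → ℤ) → ℕ → ℤ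
W^ zero    f = f
W^ (suc m) f = W (W^ m f)

-- The constant series 1, so that `W^ m δ` is (1 + 2v)^m.
δ : ℕ → ℤ
δ zero    = 1ℤ
δ (suc n) = 0ℤ

2V^-W : ∀ i f n → 2V^ i (W f) n ≡ 2V^ i f n ℤ.+ 2V^ (suc i) f n
2V^-W zero    f n       = refl
2V^-W (suc i) f zero    = refl
2V^-W (suc i) f (suc n) = trans (cong (ℤ._*_ (+ 2)) (2V^-W i f n)) (ℤ.*-distribˡ-+ (+ 2) (2V^ i f n) _)

-- On the sequence i ↦ `2V^ i f n`, the shift E is multiplication by 2v, so 1 + 2v acts as 1 + E and
-- `frobenius` becomes applicable.
2V^-W^ : ∀ f n m i → 2V^ i (W^ m f) n ≡ binomial (λ i → 2V^ i f n) m i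
2V^-W^ f n zero    i = refl
2V^-W^ f n (suc m) i = trans (2V^-W i (W^ m f) n) (cong₂ ℤ._+_ (2V^-W^ f n m i) (2V^-W^ f n m (suc i)))

2V^-vanishes : ∀ {i n} f → n < i → 2V^ i f n ≡ 0ℤ
2V^-vanishes {suc i} {zero}  f n<i = refl
2V^-vanishes {suc i} {suc n} f n<i = cong (ℤ._*_ (+ 2)) (2V^-vanishes f (ℕ.s<s⁻¹ n<i))

-- (1 + 2v)^p ≡ 1 + (2v)^p, and (2v)^p contributes nothing below degree p.
W^p-mod : ∀ {p} → Prime p → ∀ f n → n < p → W^ p f n ≡ f n ⟨mod p ⟩
W^p-mod {p} pp f n n<p =
  subst₂ (_≡_⟨mod p ⟩) (sym (2V^-W^ f n p 0)) (trans (cong (ℤ._+_ (f n)) vanish) (ℤ.+-identityʳ (f n)))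
    (frobenius pp (λ i → 2V^ i f n) 0)
  where
  vanish : 2V^ (p + 0) f n ≡ 0ℤ
  vanish = 2V^-vanishes f (subst (n <_) (sym (ℕ.+-identityʳ p)) n<p)

W^-+ : ∀ m n f → W^ (m + n) f ≡ W^ m (W^ n f)
W^-+ zero    n f = refl
W^-+ (suc m) n f = cong W (W^-+ m n f)

W^[p*3]-mod : ∀ {p} → Prime p → ∀ f n → n < p → W^ (p * 3) f n ≡ f n ⟨mod p ⟩
W^[p*3]-mod {p} pp f n n<p = subst (λ m → W^ m f n ≡ f n ⟨mod p ⟩) (ℕ.*-comm 3 p)
  -- `3 * p` unfolds to `p + (p + (p + 0))`; each `reduce` removes one factor (1 + 2v)^p.
  (reduce (p + (p + 0)) (reduce (p + 0) (reduce 0 (divides 0ℤ (ℤ.+-inverseʳ (f n))))))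
  where
  reduce : ∀ m → W^ m f n ≡ f n ⟨mod p ⟩ → W^ (p + m) f n ≡ f n ⟨mod p ⟩
  reduce m eq = mod-trans {a = W^ (p + m) f n} {W^ m f n} {f n}
    (subst (λ g → g n ≡ W^ m f n ⟨mod p ⟩) (sym (W^-+ p m f)) (W^p-mod pp (W^ m f) n n<p)) eq

W^-δ : ∀ m n → W^ m δ n ≡ + (2 ^ n * (m C n))
W^-δ zero    zero    = refl
W^-δ zero    (suc n) =
  cong +_ (sym (trans (cong (2 ^ suc n *_) (k>n⇒nCk≡0 {0} {suc n} z<s)) (ℕ.*-zeroʳ (2 ^ suc n))))
W^-δ (suc m) zero    = trans (ℤ.+-identityʳ _) (W^-δ m zero)
W^-δ (suc m) (suc n) = begin
  W^ m δ (suc n) ℤ.+ + 2 ℤ.* W^ m δ n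
    ≡⟨ cong₂ (λ a b → a ℤ.+ + 2 ℤ.* b) (W^-δ m (suc n)) (W^-δ m n) ⟩
  + (2 ^ suc n * (m C suc n)) ℤ.+ + 2 ℤ.* + (2 ^ n * (m C n))
    ≡⟨ cong (ℤ._+_ (+ (2 ^ suc n * (m C suc n)))) (ℤ.pos-* 2 (2 ^ n * (m C n))) ⟨
  + (2 ^ suc n * (m C suc n) + 2 * (2 ^ n * (m C n)))
    ≡⟨ cong +_ (cong (_+_ (2 ^ suc n * (m C suc n))) (ℕ.*-assoc 2 (2 ^ n) (m C n))) ⟨
  + (2 ^ suc n * (m C suc n) + 2 ^ suc n * (m C n))
    ≡⟨ cong +_ (ℕ.*-distribˡ-+ (2 ^ suc n) (m C suc n) (m C n)) ⟨
  + (2 ^ suc n * (m C suc n + m C n))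
    ≡⟨ cong (λ c → + (2 ^ suc n * c)) (trans (ℕ.+-comm (m C suc n) (m C n)) (nCk+nC[k+1]≡[n+1]C[k+1] m n)) ⟩
  + (2 ^ suc n * (suc m C suc n)) ∎
  where open ≡-Reasoning

-- Telescoping the sum.

sum-upTo-suc : ∀ (t : ℕ → ℕ) n → sum (map t (upTo (suc n))) ≡ sum (map t (upTo n)) + t n
sum-upTo-suc t n = begin
  sum (map t (upTo (suc n)))            ≡⟨ cong (λ ks → sum (map t ks)) (upTo-∷ʳ n) ⟨
  sum (map t (upTo n ++ n ∷ []))        ≡⟨ cong sum (map-++ t (upTo n) (n ∷ [])) ⟩
  sum (map t (upTo n) ++ t n ∷ [])      ≡⟨ sum-++ (map t (upTo n)) (t n ∷ []) ⟩
  sum (map t (upTo n)) + (t n + 0)      ≡⟨ cong (_+_ (sum (map t (upTo n)))) (ℕ.+-identityʳ (t n)) ⟩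
  sum (map t (upTo n)) + t n            ∎
  where open ≡-Reasoning

module _ (c : ℤ) (j : ℕ) (r : ℕ → ℤ)
         (W³r : ∀ n → W^ 3 r n ≡ V r n ℤ.+ c ℤ.* W^ j δ n) where

  -- The equation `W³r` multiplied by (1 + 2v)^m, one factor at a time.
  W^[m+3]r : ∀ m n → W^ (m + 3) r n ≡ V (W^ m r) n ℤ.+ c ℤ.* W^ (m + j) δ n
  W^[m+3]r zero    n       = W³r n
  W^[m+3]r (suc m) zero    = trans (cong (λ a → a ℤ.+ 0ℤ) (W^[m+3]r m zero)) (eq c (W^ (m + j) δ zero))
    where
    eq : ∀ c x → (0ℤ ℤ.+ c ℤ.* x) ℤ.+ 0ℤ ≡ 0ℤ ℤ.+ c ℤ.* (x ℤ.+ 0ℤ)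
    eq = solve-∀
  W^[m+3]r (suc m) (suc n) =
    trans (cong₂ (λ a b → a ℤ.+ + 2 ℤ.* b) (W^[m+3]r m (suc n)) (W^[m+3]r m n))
          (eq c (W^ m r n) (V (W^ m r) n) (W^ (m + j) δ (suc n)) (W^ (m + j) δ n))
    where
    eq : ∀ c x y z w → (x ℤ.+ c ℤ.* z) ℤ.+ + 2 ℤ.* (y ℤ.+ c ℤ.* w)
                     ≡ (x ℤ.+ + 2 ℤ.* y) ℤ.+ c ℤ.* (z ℤ.+ + 2 ℤ.* w)
    eq = solve-∀

  -- By `W^[m+3]r` with m = 3k, c times the k-th summand is the difference of the values of
  -- `V (W^ (n * 3) r) n` at n = k + 1 and n = k; `V` makes the value at 0 vanish.
  telescope : ∀ (e : ℕ → ℕ) → (∀ k → e k ≡ k * 3 + j) → ∀ n →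
              c ℤ.* + sum (map (λ k → 2 ^ k * (e k C k)) (upTo n)) ≡ V (W^ (n * 3) r) n
  telescope e e≡ zero    = ℤ.*-zeroʳ c
  telescope e e≡ (suc n) = begin
    c ℤ.* + sum (map t (upTo (suc n)))
      ≡⟨ cong (λ s → c ℤ.* + s) (sum-upTo-suc t n) ⟩
    c ℤ.* (+ sum (map t (upTo n)) ℤ.+ + t n)
      ≡⟨ ℤ.*-distribˡ-+ c (+ sum (map t (upTo n))) (+ t n) ⟩
    c ℤ.* + sum (map t (upTo n)) ℤ.+ c ℤ.* + t n
      ≡⟨ cong₂ (λ a b → a ℤ.+ c ℤ.* b) (telescope e e≡ n) t≡ ⟩
    V (W^ (n * 3) r) n ℤ.+ c ℤ.* W^ (n * 3 + j) δ n
      ≡⟨ W^[m+3]r (n * 3) n ⟨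
    W^ (n * 3 + 3) r n
      ≡⟨ cong (λ m → W^ m r n) (ℕ.+-comm (n * 3) 3) ⟩
    W^ (suc n * 3) r n ∎
    where
    open ≡-Reasoning
    t : ℕ → ℕ
    t k = 2 ^ k * (e k C k)
    t≡ : + t n ≡ W^ (n * 3 + j) δ n
    t≡ = trans (cong (λ m → + (2 ^ n * (m C n))) (e≡ n)) (sym (W^-δ (n * 3 + j) n))

  -- For n = p the telescoped value is the coefficient of v^(p-1) in (1 + 2v)^(3p) r, a degree low
  -- enough to drop the factor modulo p.
  sum-mod : ∀ (e : ℕ → ℕ) → (∀ k → e k ≡ k * 3 + j) → ∀ {q} → Prime (suc q) →
            c ℤ.* + sum (map (λ k → 2 ^ k * (e k C k)) (upTo (suc q))) ≡ r q ⟨mod suc q ⟩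
  sum-mod e e≡ {q} pp = subst (_≡ r q ⟨mod suc q ⟩) (sym (telescope e e≡ (suc q)))
                          (W^[p*3]-mod pp r q (ℕ.n<1+n q))

-- Gaussian integer powers as real sequences, and partial fractions.

-- Re((α − β i) iⁿ)
osc : ℤ → ℤ → ℕ → ℤ
osc α β zero          = α
osc α β (suc zero)    = β
osc α β (suc (suc n)) = ℤ.- osc α β n

-- Re((α − β i) (2 i (1 + i))ⁿ)
gauss : ℤ → ℤ → ℕ → ℤ
gauss α β n = (+ 2) ℤ.^ n ℤ.* binomial (osc α β) n n

binomial-osc : ∀ α β m n → binomial (osc α β) m (suc (suc n)) ≡ ℤ.- binomial (osc α β) m n
binomial-osc α β zero    n = refl
binomial-osc α β (suc m) n =
  trans (cong₂ ℤ._+_ (binomial-osc α β m n) (binomial-osc α β m (suc n)))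
        (sym (ℤ.neg-distrib-+ (binomial (osc α β) m n) _))

-- -2 + 2i is a root of x² + 4x + 8.
gauss-rec : ∀ α β n → gauss α β (suc (suc n)) ≡ ℤ.- (+ 4 ℤ.* gauss α β (suc n) ℤ.+ + 8 ℤ.* gauss α β n)
gauss-rec α β n = begin
  gauss α β (suc (suc n))
    -- Lowering the start index by i² = -1 leaves only `B` at n, n + 1 and n + 2, that is x, y and
    -- -x.
    ≡⟨ cong (ℤ._*_ (+ 2 ℤ.* (+ 2 ℤ.* P))) (binomial-osc α β (suc (suc n)) n) ⟩
  (+ 2 ℤ.* (+ 2 ℤ.* P)) ℤ.* ℤ.- ((x ℤ.+ y) ℤ.+ (y ℤ.+ B (suc (suc n))))
    ≡⟨ cong (λ z → (+ 2 ℤ.* (+ 2 ℤ.* P)) ℤ.* ℤ.- ((x ℤ.+ y) ℤ.+ (y ℤ.+ z))) (binomial-osc α β n n) ⟩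
  (+ 2 ℤ.* (+ 2 ℤ.* P)) ℤ.* ℤ.- ((x ℤ.+ y) ℤ.+ (y ℤ.+ ℤ.- x))
    ≡⟨ expand P x y ⟩
  ℤ.- (+ 4 ℤ.* ((+ 2 ℤ.* P) ℤ.* (y ℤ.+ ℤ.- x)) ℤ.+ + 8 ℤ.* (P ℤ.* x))
    ≡⟨ cong (λ z → ℤ.- (+ 4 ℤ.* ((+ 2 ℤ.* P) ℤ.* (y ℤ.+ z)) ℤ.+ + 8 ℤ.* (P ℤ.* x))) (binomial-osc α β n n) ⟨
  ℤ.- (+ 4 ℤ.* gauss α β (suc n) ℤ.+ + 8 ℤ.* gauss α β n) ∎
  where
  open ≡-Reasoning
  P = (+ 2) ℤ.^ n
  B : ℕ → ℤ
  B = binomial (osc α β) n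
  x = B n
  y = B (suc n)
  expand : ∀ P x y → (+ 2 ℤ.* (+ 2 ℤ.* P)) ℤ.* ℤ.- ((x ℤ.+ y) ℤ.+ (y ℤ.+ ℤ.- x))
                   ≡ ℤ.- (+ 4 ℤ.* ((+ 2 ℤ.* P) ℤ.* (y ℤ.+ ℤ.- x)) ℤ.+ + 8 ℤ.* (P ℤ.* x))
  expand = solve-∀

-- Coefficients of σ / (1 + v) + (α + (4α + β') v) / (1 + 4v + 8v²), β' = gauss α β 1.
series : ℤ → ℤ → ℤ → ℕ → ℤ
series σ α β n = σ ℤ.* -1ℤ ℤ.^ n ℤ.+ gauss α β n

-- (1 + 2v)³ − v = (1 + v)(1 + 4v + 8v²) annihilates series beyond degree 2.
W³-series : ∀ σ α β n → W^ 3 (series σ α β) (3 + n) ≡ V (series σ α β) (3 + n)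
W³-series σ α β n =
  trans (cong₂ (λ b₃ b₂ → cube (σ ℤ.* (-1ℤ ℤ.* (-1ℤ ℤ.* (-1ℤ ℤ.* s))) ℤ.+ b₃)
                               (σ ℤ.* (-1ℤ ℤ.* (-1ℤ ℤ.* s)) ℤ.+ b₂)
                               (σ ℤ.* (-1ℤ ℤ.* s) ℤ.+ b₁)
                               (σ ℤ.* s ℤ.+ b₀))
           (trans (gauss-rec α β (suc n)) (cong (λ b₂ → ℤ.- (+ 4 ℤ.* b₂ ℤ.+ + 8 ℤ.* b₁)) b₂≡)) b₂≡)
  (trans (factor σ s b₀ b₁) (cong (ℤ._+_ (σ ℤ.* (-1ℤ ℤ.* (-1ℤ ℤ.* s)))) (sym b₂≡)))
  where
  s = -1ℤ ℤ.^ n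
  b₀ = gauss α β n
  b₁ = gauss α β (suc n)
  b₂≡ = gauss-rec α β n
  -- The unfolded form of `W^ 3` on four consecutive coefficients, highest degree first.
  cube : ℤ → ℤ → ℤ → ℤ → ℤ
  cube r₃ r₂ r₁ r₀ = ((r₃ ℤ.+ + 2 ℤ.* r₂) ℤ.+ + 2 ℤ.* (r₂ ℤ.+ + 2 ℤ.* r₁))
                     ℤ.+ + 2 ℤ.* ((r₂ ℤ.+ + 2 ℤ.* r₁) ℤ.+ + 2 ℤ.* (r₁ ℤ.+ + 2 ℤ.* r₀))
  factor : ∀ σ s b₀ b₁ →
    (((σ ℤ.* (-1ℤ ℤ.* (-1ℤ ℤ.* (-1ℤ ℤ.* s))) ℤ.+ ℤ.- (+ 4 ℤ.* ℤ.- (+ 4 ℤ.* b₁ ℤ.+ + 8 ℤ.* b₀) ℤ.+ + 8 ℤ.* b₁))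
       ℤ.+ + 2 ℤ.* (σ ℤ.* (-1ℤ ℤ.* (-1ℤ ℤ.* s)) ℤ.+ ℤ.- (+ 4 ℤ.* b₁ ℤ.+ + 8 ℤ.* b₀)))
      ℤ.+ + 2 ℤ.* ((σ ℤ.* (-1ℤ ℤ.* (-1ℤ ℤ.* s)) ℤ.+ ℤ.- (+ 4 ℤ.* b₁ ℤ.+ + 8 ℤ.* b₀))
                   ℤ.+ + 2 ℤ.* (σ ℤ.* (-1ℤ ℤ.* s) ℤ.+ b₁)))
    ℤ.+ + 2 ℤ.* (((σ ℤ.* (-1ℤ ℤ.* (-1ℤ ℤ.* s)) ℤ.+ ℤ.- (+ 4 ℤ.* b₁ ℤ.+ + 8 ℤ.* b₀))
                  ℤ.+ + 2 ℤ.* (σ ℤ.* (-1ℤ ℤ.* s) ℤ.+ b₁))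
                 ℤ.+ + 2 ℤ.* ((σ ℤ.* (-1ℤ ℤ.* s) ℤ.+ b₁) ℤ.+ + 2 ℤ.* (σ ℤ.* s ℤ.+ b₀)))
    ≡ σ ℤ.* (-1ℤ ℤ.* (-1ℤ ℤ.* s)) ℤ.+ ℤ.- (+ 4 ℤ.* b₁ ℤ.+ + 8 ℤ.* b₀)
  factor = solve-∀

-- Values at exponent p - 1 modulo p.

osc-shift : ∀ α β h n → osc α β (h * 2 + n) ≡ -1ℤ ℤ.^ h ℤ.* osc α β n
osc-shift α β zero    n = sym (ℤ.*-identityˡ (osc α β n))
osc-shift α β (suc h) n =
  trans (cong ℤ.-_ (osc-shift α β h n))
  (trans (sym (ℤ.-1*i≡-i _)) (sym (ℤ.*-assoc -1ℤ (-1ℤ ℤ.^ h) (osc α β n))))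

binomial-osc-shift : ∀ α β m h → binomial (osc α β) m (h * 2) ≡ -1ℤ ℤ.^ h ℤ.* binomial (osc α β) m 0
binomial-osc-shift α β m zero    = sym (ℤ.*-identityˡ _)
binomial-osc-shift α β m (suc h) =
  trans (binomial-osc α β m (h * 2))
  (trans (cong ℤ.-_ (binomial-osc-shift α β m h))
  (trans (sym (ℤ.-1*i≡-i _)) (sym (ℤ.*-assoc -1ℤ (-1ℤ ℤ.^ h) _))))

-1^h-square : ∀ h → -1ℤ ℤ.^ h ℤ.* -1ℤ ℤ.^ h ≡ 1ℤ
-1^h-square zero    = refl
-1^h-square (suc h) = trans (eq (-1ℤ ℤ.^ h)) (-1^h-square h)
  where
  eq : ∀ s → (-1ℤ ℤ.* s) ℤ.* (-1ℤ ℤ.* s) ≡ s ℤ.* s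
  eq = solve-∀

-1^[h*2] : ∀ h → -1ℤ ℤ.^ (h * 2) ≡ 1ℤ
-1^[h*2] zero    = refl
-1^[h*2] (suc h) = trans (eq (-1ℤ ℤ.^ (h * 2))) (-1^[h*2] h)
  where
  eq : ∀ s → -1ℤ ℤ.* (-1ℤ ℤ.* s) ≡ s
  eq = solve-∀

binomial-1 : ∀ m n → binomial (λ _ → 1ℤ) m n ≡ (+ 2) ℤ.^ m
binomial-1 zero    n = refl
binomial-1 (suc m) n =
  trans (cong₂ ℤ._+_ (binomial-1 m n) (binomial-1 m (suc n))) (eq ((+ 2) ℤ.^ m))
  where
  eq : ∀ s → s ℤ.+ s ≡ + 2 ℤ.* s
  eq = solve-∀

-- Frobenius on the constant sequence 1, where E is the identity and 1 + E is 2.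
2^p≡2 : ∀ {p} → Prime p → (+ 2) ℤ.^ p ≡ + 2 ⟨mod p ⟩
2^p≡2 {p} pp = subst (_≡ + 2 ⟨mod p ⟩) (binomial-1 p 0) (frobenius pp (λ _ → 1ℤ) 0)

mod-cancelˡ : ∀ {p} k → Coprime p k → ∀ {a b} → + k ℤ.* a ≡ + k ℤ.* b ⟨mod p ⟩ → a ≡ b ⟨mod p ⟩
mod-cancelˡ {p} k cop {a} {b} ka≡kb = ∣ᵤ⇒∣ (coprime-divisor cop p∣k*∣a-b∣)
  where
  p∣k*∣a-b∣ : p ℕ.∣ k * ℤ.∣ a ℤ.- b ∣
  p∣k*∣a-b∣ = subst (p ℕ.∣_)
    (trans (cong ℤ.∣_∣ (sym (distrib (+ k) a b))) (ℤ.abs-* (+ k) (a ℤ.- b))) (∣⇒∣ᵤ ka≡kb)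
    where
    distrib : ∀ k a b → k ℤ.* (a ℤ.- b) ≡ k ℤ.* a ℤ.- k ℤ.* b
    distrib = solve-∀

-- i^p = (-1)^h i for p = 2h + 1, so Frobenius gives (1 + i)^p ≡ 1 + (-1)^h i;
-- multiplying by 1 − i yields 2 (1 + i)^(p-1).
2*binomial-osc-mod : ∀ {h} → Prime (suc (h * 2)) → ∀ α β → let ε = -1ℤ ℤ.^ h in
  + 2 ℤ.* binomial (osc α β) (h * 2) 0 ≡ (α ℤ.- β) ℤ.+ ε ℤ.* (α ℤ.+ β) ⟨mod suc (h * 2) ⟩
2*binomial-osc-mod {h} pp α β =
  subst₂ (_≡_⟨mod suc (h * 2) ⟩) lhs rhs
    -- Subtracting the instance at 1 from the one at 0 applies 1 - E, which is the multiplication by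
    -- 1 - i.
    (mod-- {a = binomial (osc α β) (suc (h * 2)) 0} {c = binomial (osc α β) (suc (h * 2)) 1}
           (frobenius pp (osc α β) 0) (frobenius pp (osc α β) 1))
  where
  ε = -1ℤ ℤ.^ h
  q = h * 2
  F₀ = binomial (osc α β) q 0
  F₁ = binomial (osc α β) q 1
  lhs : (F₀ ℤ.+ F₁) ℤ.- (F₁ ℤ.+ binomial (osc α β) q 2) ≡ + 2 ℤ.* F₀
  lhs = trans (cong (λ F₂ → (F₀ ℤ.+ F₁) ℤ.- (F₁ ℤ.+ F₂)) (binomial-osc α β q 0)) (eq F₀ F₁)
    where
    eq : ∀ F₀ F₁ → (F₀ ℤ.+ F₁) ℤ.- (F₁ ℤ.+ ℤ.- F₀) ≡ + 2 ℤ.* F₀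
    eq = solve-∀
  at : ∀ n → osc α β (suc q + n) ≡ ε ℤ.* osc α β (suc n)
  at n = trans (cong (osc α β) (sym (ℕ.+-suc q n))) (osc-shift α β h (suc n))
  rhs : (α ℤ.+ osc α β (suc q + 0)) ℤ.- (β ℤ.+ osc α β (suc q + 1)) ≡ (α ℤ.- β) ℤ.+ ε ℤ.* (α ℤ.+ β)
  rhs = trans (cong₂ (λ x y → (α ℤ.+ x) ℤ.- (β ℤ.+ y)) (at 0) (at 1)) (eq α β ε)
    where
    eq : ∀ α β ε → (α ℤ.+ ε ℤ.* β) ℤ.- (β ℤ.+ ε ℤ.* ℤ.- α) ≡ (α ℤ.- β) ℤ.+ ε ℤ.* (α ℤ.+ β)
    eq = solve-∀

-- One factor 2 completes 2^(p-1) to 2^p ≡ 2, the other completes `F₀` to the value known from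
-- `2*binomial-osc-mod`; i^(p-1) = ε and ε² = 1 do the rest.
4*gauss-mod : ∀ {h} → Prime (suc (h * 2)) → ∀ α β → let ε = -1ℤ ℤ.^ h in
  + 4 ℤ.* gauss α β (h * 2) ≡ + 2 ℤ.* ((α ℤ.+ β) ℤ.+ ε ℤ.* (α ℤ.- β)) ⟨mod suc (h * 2) ⟩
4*gauss-mod {h} pp α β =
  subst₂ (_≡_⟨mod suc (h * 2) ⟩) lhs rhs
    (mod-* {a = (+ 2) ℤ.^ suc q} {b = + 2} {c = ε ℤ.* (+ 2 ℤ.* F₀)}
           (2^p≡2 pp)
           (mod-* {a = ε} {b = ε} {c = + 2 ℤ.* F₀} (divides 0ℤ (ℤ.+-inverseʳ ε))
                  (2*binomial-osc-mod {h} pp α β)))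
  where
  ε = -1ℤ ℤ.^ h
  q = h * 2
  F₀ = binomial (osc α β) q 0
  lhs : (+ 2) ℤ.^ suc q ℤ.* (ε ℤ.* (+ 2 ℤ.* F₀)) ≡ + 4 ℤ.* gauss α β q
  lhs = trans (eq ((+ 2) ℤ.^ q) ε F₀) (cong (λ F → + 4 ℤ.* ((+ 2) ℤ.^ q ℤ.* F)) (sym (binomial-osc-shift α β q h)))
    where
    eq : ∀ P ε F → (+ 2 ℤ.* P) ℤ.* (ε ℤ.* (+ 2 ℤ.* F)) ≡ + 4 ℤ.* (P ℤ.* (ε ℤ.* F))
    eq = solve-∀
  rhs : + 2 ℤ.* (ε ℤ.* ((α ℤ.- β) ℤ.+ ε ℤ.* (α ℤ.+ β))) ≡ + 2 ℤ.* ((α ℤ.+ β) ℤ.+ ε ℤ.* (α ℤ.- β))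
  rhs = trans (eq α β ε)
       (trans (cong (λ s → + 2 ℤ.* (s ℤ.* (α ℤ.+ β) ℤ.+ ε ℤ.* (α ℤ.- β))) (-1^h-square h))
              (eq′ α β ε))
    where
    eq : ∀ α β ε → + 2 ℤ.* (ε ℤ.* ((α ℤ.- β) ℤ.+ ε ℤ.* (α ℤ.+ β)))
                 ≡ + 2 ℤ.* ((ε ℤ.* ε) ℤ.* (α ℤ.+ β) ℤ.+ ε ℤ.* (α ℤ.- β))
    eq = solve-∀
    eq′ : ∀ α β ε → + 2 ℤ.* (1ℤ ℤ.* (α ℤ.+ β) ℤ.+ ε ℤ.* (α ℤ.- β)) ≡ + 2 ℤ.* ((α ℤ.+ β) ℤ.+ ε ℤ.* (α ℤ.- β))
    eq′ = solve-∀

-- From integer congruences to p-integral rationals.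

-- Reduction to lowest terms replaces n by one of its divisors.
/-Integral : ∀ {p} i n .{{_ : ℕ.NonZero n}} → Coprime n p → (p -Integral) (i ℚ./ n)
/-Integral i n cop (d∣↧ , d∣p) = cop (ℕ.∣-trans d∣↧ ↧∣n , d∣p)
  where
  ↧∣n : ↧ₙ (i ℚ./ n) ℕ.∣ n
  ↧∣n = ℕ.divides ℤ.∣ gcd i (+ n) ∣ (trans (cong ℤ.∣_∣ (sym (ℚ.↧-/ i n)))
          (trans (ℤ.abs-* (↧ (i ℚ./ n)) (gcd i (+ n))) (ℕ.*-comm (↧ₙ (i ℚ./ n)) _)))

[mod]-fraction : ∀ {p} s a n → Coprime (suc n) p → + suc n ℤ.* s ≡ a ⟨mod p ⟩ →
                 s ℚ./ 1 ≡ a ℚ./ suc n [mod p ]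
[mod]-fraction {p} s a n cop (divides k eq) =
  /-Integral s 1 (Coprimality.1-coprimeTo p) , /-Integral a (suc n) cop ,
  -- From (n+1) s - a = k p the quotient is k/(n+1). The check runs in ℚᵘ, where both sides have the
  -- same denominator before any reduction.
  k ℚ./ suc n , /-Integral k (suc n) cop , ℚ.toℚᵘ-injective (begin
    toℚᵘ (s ℚ./ 1 ℚ.- a ℚ./ suc n)
      ≈⟨ ℚ.toℚᵘ-homo-+ (s ℚ./ 1) (ℚ.- (a ℚ./ suc n)) ⟩
    toℚᵘ (s ℚ./ 1) ℚᵘ.+ toℚᵘ (ℚ.- (a ℚ./ suc n))
      ≈⟨ ℚᵘ.+-congʳ (toℚᵘ (s ℚ./ 1)) (ℚ.toℚᵘ-homo‿- (a ℚ./ suc n)) ⟩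
    toℚᵘ (s ℚ./ 1) ℚᵘ.- toℚᵘ (a ℚ./ suc n)
      ≈⟨ ℚᵘ.+-cong (ℚ.toℚᵘ-fromℚᵘ (mkℚᵘ s 0)) (ℚᵘ.-‿cong (ℚ.toℚᵘ-fromℚᵘ (mkℚᵘ a n))) ⟩
    mkℚᵘ s 0 ℚᵘ.- mkℚᵘ a n
      ≈⟨ *≡* (cong₂ ℤ._*_ numerators refl) ⟩
    mkℚᵘ (+ p) 0 ℚᵘ.* mkℚᵘ k n
      ≈⟨ ℚᵘ.*-cong (ℚ.toℚᵘ-fromℚᵘ (mkℚᵘ (+ p) 0)) (ℚ.toℚᵘ-fromℚᵘ (mkℚᵘ k n)) ⟨
    toℚᵘ (+ p ℚ./ 1) ℚᵘ.* toℚᵘ (k ℚ./ suc n)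
      ≈⟨ ℚ.toℚᵘ-homo-* (+ p ℚ./ 1) (k ℚ./ suc n) ⟨
    toℚᵘ ((+ p ℚ./ 1) ℚ.* (k ℚ./ suc n)) ∎)
  where
  open ℚᵘ.≃-Reasoning
  normalise : ∀ n s a → s ℤ.* n ℤ.+ ℤ.- a ℤ.* 1ℤ ≡ n ℤ.* s ℤ.- a
  normalise = solve-∀
  numerators : s ℤ.* + suc n ℤ.+ ℤ.- a ℤ.* 1ℤ ≡ + p ℤ.* k
  numerators = trans (normalise (+ suc n) s a) (trans eq (ℤ.*-comm k (+ p)))

-- Assembling the two congruences.

-- (-1)^(p-1) = 1 leaves σ plus the Gaussian part; that part is known only after multiplication by
-- 4, which cancels because p > 4 is prime.
series-mod : ∀ {h} → Prime (suc (h * 2)) → 4 < suc (h * 2) → ∀ σ α β a →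
             + 4 ℤ.* a ≡ + 4 ℤ.* σ ℤ.+ + 2 ℤ.* ((α ℤ.+ β) ℤ.+ -1ℤ ℤ.^ h ℤ.* (α ℤ.- β)) →
             series σ α β (h * 2) ≡ a ⟨mod suc (h * 2) ⟩
series-mod {h} pp 4<p σ α β a a≡ = mod-cancelˡ 4 (prime⇒coprime pp 4<p) {series σ α β (h * 2)} {a}
  (subst (+ suc (h * 2) ∣_) difference (4*gauss-mod {h} pp α β))
  where
  g = gauss α β (h * 2)
  rest = + 2 ℤ.* ((α ℤ.+ β) ℤ.+ -1ℤ ℤ.^ h ℤ.* (α ℤ.- β))
  shift : ∀ g c σ → + 4 ℤ.* g ℤ.- c ≡ + 4 ℤ.* (σ ℤ.* 1ℤ ℤ.+ g) ℤ.- (+ 4 ℤ.* σ ℤ.+ c)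
  shift = solve-∀
  difference : + 4 ℤ.* g ℤ.- rest ≡ + 4 ℤ.* series σ α β (h * 2) ℤ.- + 4 ℤ.* a
  difference = trans (shift g rest σ)
    (cong₂ (λ s x → + 4 ℤ.* (σ ℤ.* s ℤ.+ g) ℤ.- x) (sym (-1^[h*2] h)) (sym a≡))

odd-prime : ∀ {p} → Prime p → 2 < p → ∃[ h ] p ≡ suc (h * 2)
odd-prime {p} pp 2<p with p ℕ.% 2 in eq | ℕ.m%n<n p 2
... | 0 | _ with prime⇒irreducible pp (ℕ.m%n≡0⇒n∣m p 2 eq)
...   | inj₁ ()
...   | inj₂ refl = contradiction 2<p (ℕ.<-irrefl refl)
odd-prime {p} pp 2<p | 1 | _ = p / 2 , trans (ℕ.m≡m%n+[m/n]*n p 2) (cong (_+ p / 2 * 2) eq)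
odd-prime {p} pp 2<p | suc (suc _) | s<s (s<s ())

-- The first hypothesis is the power series equation for r, the second evaluates r at p - 1. `a` is
-- a function of the sign ε, so one polynomial identity covers every p.
sum-congruence : ∀ (j : ℕ) σ α β (a : ℤ → ℤ) →
  (∀ n → W^ 3 (series σ α β) n ≡ V (series σ α β) n ℤ.+ + 5 ℤ.* W^ j δ n) →
  (∀ ε → + 4 ℤ.* a ε ≡ + 4 ℤ.* σ ℤ.+ + 2 ℤ.* ((α ℤ.+ β) ℤ.+ ε ℤ.* (α ℤ.- β))) →
  ∀ (e : ℕ → ℕ) → (∀ k → e k ≡ k * 3 + j) → ∀ {p} → Prime p → 5 < p →
  (+ sum (map (λ k → 2 ^ k * (e k C k)) (upTo p))) ℚ./ 1 ≡ a (-1ℤ ℤ.^ ((p ∸ 1) / 2)) ℚ./ 5 [mod p ]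
sum-congruence j σ α β a W³r a≡ e e≡ {p} pp 5<p =
  [mod]-fraction (+ S p) (a (-1ℤ ℤ.^ ((p ∸ 1) / 2))) 4 (Coprimality.sym (prime⇒coprime pp 5<p))
    (reduce pp 5<p (odd-prime pp (ℕ.<-trans (s<s (s<s z<s)) 5<p)))
  where
  S : ℕ → ℕ
  S n = sum (map (λ k → 2 ^ k * (e k C k)) (upTo n))
  reduce : ∀ {p} → Prime p → 5 < p → ∃[ h ] p ≡ suc (h * 2) →
           + 5 ℤ.* + S p ≡ a (-1ℤ ℤ.^ ((p ∸ 1) / 2)) ⟨mod p ⟩
  reduce pp 5<p (h , refl) =
    subst (λ m → + 5 ℤ.* + S (suc (h * 2)) ≡ a (-1ℤ ℤ.^ m) ⟨mod suc (h * 2) ⟩) (sym (ℕ.m*n/n≡m h 2))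
      (mod-trans {a = + 5 ℤ.* + S (suc (h * 2))} {series σ α β (h * 2)} {a (-1ℤ ℤ.^ h)}
        (sum-mod (+ 5) j (series σ α β) W³r e e≡ pp)
        (series-mod {h} pp (ℕ.<-trans (ℕ.n<1+n 4) 5<p) σ α β (a (-1ℤ ℤ.^ h)) (a≡ (-1ℤ ℤ.^ h))))

theorem1p2 : ∀ (p : ℕ) → Prime p → 5 < p →
    ((+ sum (map (λ k → 2 ^ k * ((3 * k) C k)) (upTo p))) ℚ./ 1
    ≡ ((+ 6) ℤ.* (-1ℤ ℤ.^ ((p ∸ 1) / 2)) ℤ.- (+ 1)) ℚ./ 5 [mod p ])
    × ((+ sum (map (λ k → 2 ^ k * ((3 * k + 1) C k)) (upTo p))) ℚ./ 1
    ≡ ((+ 4) ℤ.* (-1ℤ ℤ.^ ((p ∸ 1) / 2)) ℤ.+ (+ 1)) ℚ./ 5 [mod p ])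
theorem1p2 p pp 5<p =
    -- Partial fractions: 5 = (1 + 4v + 8v²) + (4 - 8v)(1 + v).
    sum-congruence 0 1ℤ (+ 4) (ℤ.- + 8) (λ ε → + 6 ℤ.* ε ℤ.- + 1) W³r₀ a₀ (3 *_)
      (λ k → trans (ℕ.*-comm 3 k) (sym (ℕ.+-identityʳ (k * 3)))) pp 5<p
  -- Here 5 (1 + 2v) = -(1 + 4v + 8v²) + (6 + 8v)(1 + v).
  , sum-congruence 1 -1ℤ (+ 6) (ℤ.- + 2) (λ ε → + 4 ℤ.* ε ℤ.+ + 1) W³r₁ a₁ (λ k → 3 * k + 1)
      (λ k → cong (_+ 1) (ℕ.*-comm 3 k)) pp 5<p
  where
  r₀ r₁ : ℕ → ℤ
  r₀ = series 1ℤ (+ 4) (ℤ.- + 8)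
  r₁ = series -1ℤ (+ 6) (ℤ.- + 2)
  W³r₀ : ∀ n → W^ 3 r₀ n ≡ V r₀ n ℤ.+ + 5 ℤ.* W^ 0 δ n
  -- The right-hand side 5 (1 + 2v)^j and the initial values enter only in degrees 0 to 2, which
  -- compute.
  W³r₀ 0 = refl
  W³r₀ 1 = refl
  W³r₀ 2 = refl
  W³r₀ (suc (suc (suc n))) = trans (W³-series 1ℤ (+ 4) (ℤ.- + 8) n) (sym (ℤ.+-identityʳ _))
  W³r₁ : ∀ n → W^ 3 r₁ n ≡ V r₁ n ℤ.+ + 5 ℤ.* W^ 1 δ n
  W³r₁ 0 = refl
  W³r₁ 1 = refl
  W³r₁ 2 = refl
  W³r₁ (suc (suc (suc n))) = trans (W³-series -1ℤ (+ 6) (ℤ.- + 2) n) (sym (ℤ.+-identityʳ _))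
  a₀ : ∀ ε → + 4 ℤ.* (+ 6 ℤ.* ε ℤ.- + 1)
           ≡ + 4 ℤ.* 1ℤ ℤ.+ + 2 ℤ.* ((+ 4 ℤ.+ ℤ.- + 8) ℤ.+ ε ℤ.* (+ 4 ℤ.- ℤ.- + 8))
  a₀ = solve-∀
  a₁ : ∀ ε → + 4 ℤ.* (+ 4 ℤ.* ε ℤ.+ + 1)
           ≡ + 4 ℤ.* -1ℤ ℤ.+ + 2 ℤ.* ((+ 6 ℤ.+ ℤ.- + 2) ℤ.+ ε ℤ.* (+ 6 ℤ.- ℤ.- + 2))
  a₁ = solve-∀
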